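{- For every $k\ge 4$ and all $x_1,x_2\ge 0$ with $x_1+x_2\le 1$, $C_k(x_1,x_2)\le C_{k+1}(x_1,x_2)$.
   Context: The $k$-simplex is $\{x\in\mathbb{R}^k: x\ge 0,\ \sum_i x_i=1\}$. Let $F(z)=\min\{(11/6)z,1\}$ for $z\in[0,1]$, and let $F'(z)=11/6$ for $z\in[0,6/11]$ and $F'(z)=0$ otherwise. For a point $(x_1,\dots,x_k)$ of the $k$-simplex define $$d_k(x_1,\ldots,x_k)=\frac{1}{k!}\sum_{\sigma}\Big(F'(x_1)\prod_{i:\sigma(i)<\sigma(1)}[1-F(x_i)]+F'(x_2)\prod_{i:\sigma(i)<\sigma(2)}[1-F(x_i)]\Big),$$ the sum being over all permutations $\sigma$ of $\{1,\dots,k\}$. For $k\ge 3$ and $x_1,x_2\ge0$ with $x_1+x_2\le1$ define $C_k(x_1,x_2)=d_k(x_1,x_2,c,\ldots,c)$ where $c=(1-x_1-x_2)/(k-2)$. -}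

module Defs where

open import Level using (Level; _⊔_; 0ℓ) renaming (suc to lsuc)
open import Algebra.Bundles using (CommutativeRing)
open import Algebra.Construct.NaturalChoice.Min using () renaming (_⊓_ to minOf)
import Algebra.Definitions.RawMonoid as RawMonoidDefs
open import Data.Bool.Base using (if_then_else_)
open import Data.Fin.Base using (Fin; zero; suc; punchIn)
open import Data.Fin.Permutation as Perm
  using (Permutation′; insert; remove; insert-remove; insert-punchIn; _⟨$⟩ʳ_)
open import Data.Fin.Properties using (_<?_; punchIn-injective)
open import Data.List.Base using (List; []; [_]; allFin; cartesianProductWith; foldr; map)
import Data.List.Membership.Setoid as Membership
open import Data.List.Membership.Setoid.Properties using (∈-cartesianProductWith⁺; ∈-resp-≈)
open import Data.List.Membership.Propositional.Properties using (∈-allFin)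
open import Data.List.Relation.Unary.All using ([])
open import Data.List.Relation.Unary.AllPairs using ([]; _∷_)
open import Data.List.Relation.Unary.Any using (here)
import Data.List.Relation.Unary.Unique.Setoid as UniqueSetoid
open import Data.List.Relation.Unary.Unique.Setoid.Properties using (cartesianProductWith⁺)
open import Data.List.Relation.Unary.Unique.Propositional.Properties using (allFin⁺)
open import Data.Nat.Base as ℕ using (ℕ; zero; suc; s≤s; _!)
open import Data.Product.Base using (∃; _×_; _,_)
open import Data.Vec.Functional using (Vector) renaming (_∷_ to infixr 5 _∷ᵥ_)
open import Relation.Binary.Bundles using (Setoid; DecTotalOrder)
open import Relation.Binary.Core using (Rel)
open import Relation.Binary.PropositionalEquality as ≡ using (_≡_)
open import Relation.Binary.Structures using (IsDecTotalOrder)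
open import Relation.Nullary.Decidable.Core using (does)
open import Relation.Nullary.Negation.Core using (¬_)
open import Relation.Unary using (Pred)

-- The real numbers, given axiomatically: a Dedekind-complete ordered field is
-- determined up to unique isomorphism.  As in classical analysis the order is
-- decidable; the discontinuous function F′ below is defined by cases on it.
-- The inverse is total, and nothing but congruence is assumed about 0# ⁻¹.
record CompleteOrderedField (c ℓ₁ ℓ₂ : Level) : Set (lsuc (c ⊔ ℓ₁ ⊔ ℓ₂)) where
  infix  4 _≤_
  infixl 7 _/_
  infix  8 _⁻¹
  field
    commutativeRing : CommutativeRing c ℓ₁
  open CommutativeRing commutativeRing public
  field
    _⁻¹             : Carrier → Carrier
    ⁻¹-cong         : ∀ {x y} → x ≈ y → x ⁻¹ ≈ y ⁻¹
    *-inverseʳ      : ∀ x → ¬ x ≈ 0# → x * x ⁻¹ ≈ 1#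
    0≉1             : ¬ 0# ≈ 1#
    _≤_             : Rel Carrier ℓ₂
    isDecTotalOrder : IsDecTotalOrder _≈_ _≤_
    +-monoʳ-≤       : ∀ x {y z} → y ≤ z → x + y ≤ x + z
    *-nonNegative   : ∀ {x y} → 0# ≤ x → 0# ≤ y → 0# ≤ x * y

  UpperBound : Pred Carrier (c ⊔ ℓ₁ ⊔ ℓ₂) → Carrier → Set (c ⊔ ℓ₁ ⊔ ℓ₂)
  UpperBound P u = ∀ {x} → P x → x ≤ u

  field
    supremum : (P : Pred Carrier (c ⊔ ℓ₁ ⊔ ℓ₂)) → ∃ P → ∃ (UpperBound P) →
               ∃ λ s → UpperBound P s × (∀ {u} → UpperBound P u → s ≤ u)

  decTotalOrder : DecTotalOrder c ℓ₁ ℓ₂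
  decTotalOrder = record { isDecTotalOrder = isDecTotalOrder }

  open DecTotalOrder decTotalOrder public using (_≤?_; totalOrder)

  min : Carrier → Carrier → Carrier
  min = minOf totalOrder

  _/_ : Carrier → Carrier → Carrier
  x / y = x * y ⁻¹

  fromℕ : ℕ → Carrier
  fromℕ n = RawMonoidDefs._×_ +-rawMonoid n 1#

  product : ∀ {n} → Vector Carrier n → Carrier
  product = RawMonoidDefs.sum *-rawMonoid

  sumList : List Carrier → Carrier
  sumList = foldr _+_ 0#

-- A permutation of Fin (suc n) is determined by the image j of zero and by the
-- permutation of Fin n that remains when zero and j are deleted.
permutations : ∀ n → List (Permutation′ n)
permutations zero    = [ Perm.id ]
permutations (suc n) = cartesianProductWith (insert zero) (allFin (suc n)) (permutations n)

permutationSetoid : ℕ → Setoid 0ℓ 0ℓ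
permutationSetoid n = record
  { Carrier       = Permutation′ n
  ; _≈_           = Perm._≈_
  ; isEquivalence = record
    { refl  = λ _ → ≡.refl
    ; sym   = λ p i → ≡.sym (p i)
    ; trans = λ p q i → ≡.trans (p i) (q i)
    }
  }

private
  insert₀-cong : ∀ {n j k} {π ρ : Permutation′ n} → j ≡ k → π Perm.≈ ρ →
                 insert zero j π Perm.≈ insert zero k ρ
  insert₀-cong ≡.refl p zero = ≡.refl
  insert₀-cong {j = j} {π = π} {ρ} ≡.refl p (suc i) =
    ≡.trans (insert-punchIn zero j π i)
      (≡.trans (≡.cong (punchIn j) (p i)) (≡.sym (insert-punchIn zero j ρ i)))

  insert₀-injective : ∀ {n j k} {π ρ : Permutation′ n} →
                      insert zero j π Perm.≈ insert zero k ρ → j ≡ k × π Perm.≈ ρ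
  insert₀-injective {j = j} {π = π} {ρ} p with p zero
  ... | ≡.refl = ≡.refl , λ i → punchIn-injective j _ _
    (≡.trans (≡.sym (insert-punchIn zero j π i))
      (≡.trans (p (suc i)) (insert-punchIn zero j ρ i)))

-- Every permutation occurs in the list, exactly once (up to pointwise equality).
permutations-complete : ∀ n (π : Permutation′ n) → Membership._∈_ (permutationSetoid n) π (permutations n)
permutations-complete zero    π = here λ ()
permutations-complete (suc n) π =
  ∈-resp-≈ (permutationSetoid (suc n)) {x = insert zero (π ⟨$⟩ʳ zero) (remove zero π)} {y = π}
    (insert-remove zero π)
    (∈-cartesianProductWith⁺ (≡.setoid (Fin (suc n))) (permutationSetoid n) (permutationSetoid (suc n))
      insert₀-cong (∈-allFin (π ⟨$⟩ʳ zero)) (permutations-complete n (remove zero π)))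

permutations-unique : ∀ n → UniqueSetoid.Unique (permutationSetoid n) (permutations n)
permutations-unique zero    = [] ∷ []
permutations-unique (suc n) =
  cartesianProductWith⁺ (≡.setoid (Fin (suc n))) (permutationSetoid n) (permutationSetoid (suc n))
    (insert zero) insert₀-injective (allFin⁺ (suc n)) (permutations-unique n)

module _ {c ℓ₁ ℓ₂} (R : CompleteOrderedField c ℓ₁ ℓ₂) where
  open CompleteOrderedField R hiding (zero)

  -- F and F′ are only meant on [0,1]; here the same formulas are used on all of R.
  F : Carrier → Carrier
  F z = min (fromℕ 11 / fromℕ 6 * z) 1#

  F′ : Carrier → Carrier
  F′ z = if does (z ≤? fromℕ 6 / fromℕ 11) then fromℕ 11 / fromℕ 6 else 0#

  -- ∏ of 1 - F (x i) over those i with σ i < σ j.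
  survival : ∀ {k} → Vector Carrier k → Permutation′ k → Fin k → Carrier
  survival x σ j =
    product λ i → if does (σ ⟨$⟩ʳ i <? σ ⟨$⟩ʳ j) then 1# - F (x i) else 1#

  -- The coordinates x₁ and x₂ are those with index zero and suc zero.
  d : ∀ k → 2 ℕ.≤ k → Vector Carrier k → Carrier
  d k@(suc (suc _)) _ x = 1# / fromℕ (k !) * sumList (map summand (permutations k))
    where
    summand : Permutation′ k → Carrier
    summand σ = F′ (x zero) * survival x σ zero + F′ (x (suc zero)) * survival x σ (suc zero)
  d (suc zero) (s≤s ())

  C : ∀ k → 3 ℕ.≤ k → Carrier → Carrier → Carrier
  C k@(suc (suc m@(suc _))) _ x₁ x₂ =
    d k (s≤s (s≤s ℕ.z≤n)) (x₁ ∷ᵥ x₂ ∷ᵥ λ _ → (1# - x₁ - x₂) / fromℕ m)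
  C (suc (suc zero)) (s≤s (s≤s ()))
  C (suc zero) (s≤s ())

{-# OPTIONS --safe #-}

-- Write m = k - 2 and let a, b, q be the values of 1 - F at x₁, x₂ and at the other m
-- coordinates.  Counting permutations by the number l of those other coordinates that precede
-- the first one turns its share of the sum into m! ∑_{l ≤ m} ((l+1) b + (m+1-l)) qˡ, and
-- likewise with a for the second one.  As m ≥ 2, the capped branch of F is never reached at the
-- other coordinates, so passing from k to k + 1 replaces q by r with (m+1) r = m q + 1.
-- By AM-GM, (m+1) rʲ ≥ j qʲ⁻¹ + (m+1-j) qʲ; inserting this into the sum for m + 1 and
-- collecting the powers of q gives exactly (m+3)/(m+1) times the sum for m.

module Submission where

open import Defs
import Algebra.Construct.NaturalChoice.Min as Min
import Algebra.Construct.NaturalChoice.MinOp as MinOp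
import Algebra.Properties.AbelianGroup as AbelianGroupProperties
import Algebra.Properties.Monoid.Sum as MonoidSum
import Algebra.Properties.Ring as RingProperties
import Algebra.Properties.Semiring.Exp as Exp
import Algebra.Properties.Semiring.Mult as Mult
import Algebra.Properties.Semiring.Sum as Sum
import Algebra.Solver.Ring.NaturalCoefficients.Default as Solver
open import Data.Bool.Base using (Bool; true; false; if_then_else_)
open import Data.Fin.Base using (Fin; zero; suc; toℕ; punchIn)
open import Data.Fin.Permutation using (Permutation′; insert; insert-punchIn; _⟨$⟩ʳ_)
open import Data.Fin.Properties using (toℕ<n)
open import Data.List.Base using (List; []; _∷_; map; _++_; cartesianProductWith; tabulate)
open import Data.Nat.Base as ℕ using (ℕ; zero; suc; pred; z≤n; s≤s; _∸_; _<ᵇ_; _!)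
open import Data.Nat.Properties as ℕₚ using (<⇒≤; m≤n⇒m≤1+n)
open import Data.Sum.Base using (inj₁; inj₂)
open import Data.Vec.Functional using (Vector) renaming (_∷_ to infixr 5 _∷ᵥ_)
open import Function.Base using (_∘_)
open import Level using (Level)
open import Relation.Binary.Bundles using (DecTotalOrder)
open import Relation.Binary.PropositionalEquality as ≡ using (_≡_)
import Relation.Binary.Reasoning.PartialOrder as PartialOrderReasoning
open import Relation.Nullary.Decidable.Core using (does)
open import Relation.Nullary.Negation.Core using (¬_)

private
  variable
    n : ℕ

toℕ-punchIn-≤ : ∀ (l : Fin (suc n)) (p : Fin n) → toℕ l ℕ.≤ toℕ p → toℕ (punchIn l p) ≡ suc (toℕ p)
toℕ-punchIn-≤ zero    p       _         = ≡.refl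
toℕ-punchIn-≤ (suc l) (suc p) (s≤s l≤p) = ≡.cong suc (toℕ-punchIn-≤ l p l≤p)

toℕ-punchIn-> : ∀ (l : Fin (suc n)) (p : Fin n) → toℕ p ℕ.< toℕ l → toℕ (punchIn l p) ≡ toℕ p
toℕ-punchIn-> (suc l) zero    _         = ≡.refl
toℕ-punchIn-> (suc l) (suc p) (s≤s p<l) = ≡.cong suc (toℕ-punchIn-> l p p<l)

punchIn-<ᵇ-suc : ∀ (l : Fin (suc n)) (p : Fin n) j → toℕ l ℕ.≤ j →
                 (toℕ (punchIn l p) <ᵇ suc j) ≡ (toℕ p <ᵇ j)
punchIn-<ᵇ-suc zero    p       j       _         = ≡.refl
punchIn-<ᵇ-suc (suc l) zero    (suc j) _         = ≡.refl
punchIn-<ᵇ-suc (suc l) (suc p) (suc j) (s≤s l≤j) = punchIn-<ᵇ-suc l p j l≤j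

punchIn-<ᵇ : ∀ (l : Fin (suc n)) (p : Fin n) j → j ℕ.≤ toℕ l →
             (toℕ (punchIn l p) <ᵇ j) ≡ (toℕ p <ᵇ j)
punchIn-<ᵇ l       p       zero    _         = ≡.refl
punchIn-<ᵇ (suc l) zero    (suc j) _         = ≡.refl
punchIn-<ᵇ (suc l) (suc p) (suc j) (s≤s j≤l) = punchIn-<ᵇ l p j j≤l

<⇒<ᵇ≡true : ∀ {i j} → i ℕ.< j → (i <ᵇ j) ≡ true
<⇒<ᵇ≡true {zero}  (s≤s _)         = ≡.refl
<⇒<ᵇ≡true {suc i} (s≤s i<j@(s≤s _)) = <⇒<ᵇ≡true i<j

≥⇒<ᵇ≡false : ∀ {i j} → j ℕ.≤ i → (i <ᵇ j) ≡ false
≥⇒<ᵇ≡false z≤n       = ≡.refl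
≥⇒<ᵇ≡false (s≤s j≤i) = ≥⇒<ᵇ≡false j≤i

module _ {c ℓ₁ ℓ₂ : Level} (R : CompleteOrderedField c ℓ₁ ℓ₂) where
  open CompleteOrderedField R hiding (zero)
  open DecTotalOrder decTotalOrder using (total; antisym; poset)
    renaming (refl to ≤-refl; trans to ≤-trans; reflexive to ≤-reflexive)
  open PartialOrderReasoning poset
  open AbelianGroupProperties +-abelianGroup using (xyx⁻¹≈y) renaming (∙-cancelʳ to +-cancelʳ)
  open RingProperties ring using (-‿distribˡ-*; -‿distribʳ-*; -‿involutive)
  open Exp semiring using (_^_)
  open Mult semiring using (×-homo-+; ×1-homo-*)
  open Sum semiring using (sum; sum-cong-≋; ∑-distrib-+; ∑-comm; *-distribˡ-sum)
  open Solver commutativeSemiring using (solve; _:+_; _:*_; _:=_; con)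

  fromℕ-+ : ∀ m n → fromℕ (m ℕ.+ n) ≈ fromℕ m + fromℕ n
  fromℕ-+ = ×-homo-+ 1#

  fromℕ-* : ∀ m n → fromℕ (m ℕ.* n) ≈ fromℕ m * fromℕ n
  fromℕ-* = ×1-homo-*

  fromℕ-≡ : ∀ {m n} → m ≡ n → fromℕ m ≈ fromℕ n
  fromℕ-≡ ≡.refl = refl

  -- Ordered fields

  +-mono-≤ : ∀ {w x y z} → w ≤ x → y ≤ z → w + y ≤ x + z
  +-mono-≤ {w} {x} {y} {z} w≤x y≤z = begin
    w + y ≤⟨ +-monoʳ-≤ w y≤z ⟩
    w + z ≈⟨ +-comm w z ⟩
    z + w ≤⟨ +-monoʳ-≤ z w≤x ⟩
    z + x ≈⟨ +-comm z x ⟩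
    x + z ∎

  x+[y-x]≈y : ∀ x y → x + (y - x) ≈ y
  x+[y-x]≈y x y = trans (sym (+-assoc x y (- x))) (xyx⁻¹≈y x y)

  +-cancelʳ-≤ : ∀ z {x y} → x + z ≤ y + z → x ≤ y
  +-cancelʳ-≤ z {x} {y} x+z≤y+z = begin
    x              ≈⟨ [w+z]-z≈w x ⟨
    - z + (x + z)  ≤⟨ +-monoʳ-≤ (- z) x+z≤y+z ⟩
    - z + (y + z)  ≈⟨ [w+z]-z≈w y ⟩
    y              ∎
    where
    [w+z]-z≈w : ∀ w → - z + (w + z) ≈ w
    [w+z]-z≈w w = begin-equality
      - z + (w + z) ≈⟨ +-comm (- z) (w + z) ⟩
      (w + z) - z   ≈⟨ +-assoc w z (- z) ⟩
      w + (z - z)   ≈⟨ +-congˡ (-‿inverseʳ z) ⟩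
      w + 0#        ≈⟨ +-identityʳ w ⟩
      w             ∎

  x≤y⇒0≤y-x : ∀ {x y} → x ≤ y → 0# ≤ y - x
  x≤y⇒0≤y-x {x} {y} x≤y = +-cancelʳ-≤ x (begin
    0# + x       ≈⟨ +-identityˡ x ⟩
    x            ≤⟨ x≤y ⟩
    y            ≈⟨ x+[y-x]≈y x y ⟨
    x + (y - x)  ≈⟨ +-comm x (y - x) ⟩
    y - x + x    ∎)

  x≤x+y : ∀ x {y} → 0# ≤ y → x ≤ x + y
  x≤x+y x {y} 0≤y = begin
    x      ≈⟨ +-identityʳ x ⟨
    x + 0# ≤⟨ +-monoʳ-≤ x 0≤y ⟩
    x + y  ∎

  +-nonNegative : ∀ {x y} → 0# ≤ x → 0# ≤ y → 0# ≤ x + y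
  +-nonNegative {x} 0≤x 0≤y = ≤-trans 0≤x (x≤x+y x 0≤y)

  *-monoˡ-≤-nonNeg : ∀ {x y z} → 0# ≤ x → y ≤ z → x * y ≤ x * z
  *-monoˡ-≤-nonNeg {x} {y} {z} 0≤x y≤z = begin
    x * y               ≤⟨ x≤x+y (x * y) (*-nonNegative 0≤x (x≤y⇒0≤y-x y≤z)) ⟩
    x * y + x * (z - y) ≈⟨ distribˡ x y (z - y) ⟨
    x * (y + (z - y))   ≈⟨ *-congˡ (x+[y-x]≈y y z) ⟩
    x * z               ∎

  square-nonNegative : ∀ x → 0# ≤ x * x
  square-nonNegative x with total 0# x
  ... | inj₁ 0≤x = *-nonNegative 0≤x 0≤x
  ... | inj₂ x≤0 = begin
    0#            ≤⟨ *-nonNegative 0≤-x 0≤-x ⟩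
    - x * - x     ≈⟨ -‿distribˡ-* x (- x) ⟨
    - (x * - x)   ≈⟨ -‿cong (-‿distribʳ-* x x) ⟨
    - (- (x * x)) ≈⟨ -‿involutive (x * x) ⟩
    x * x         ∎
    where
    0≤-x : 0# ≤ - x
    0≤-x = ≤-trans (x≤y⇒0≤y-x x≤0) (≤-reflexive (+-identityˡ (- x)))

  0≤1 : 0# ≤ 1#
  0≤1 = ≤-trans (square-nonNegative 1#) (≤-reflexive (*-identityˡ 1#))

  0≤fromℕ : ∀ n → 0# ≤ fromℕ n
  0≤fromℕ zero    = ≤-refl
  0≤fromℕ (suc n) = +-nonNegative 0≤1 (0≤fromℕ n)

  fromℕ-mono-≤ : ∀ {m n} → m ℕ.≤ n → fromℕ m ≤ fromℕ n
  fromℕ-mono-≤ {n = n} z≤n   = 0≤fromℕ n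
  fromℕ-mono-≤ (s≤s m≤n) = +-monoʳ-≤ 1# (fromℕ-mono-≤ m≤n)

  fromℕ-suc≉0 : ∀ n → ¬ fromℕ (suc n) ≈ 0#
  fromℕ-suc≉0 n 1+n≈0 = 0≉1 (antisym 0≤1 (begin
    1#           ≤⟨ x≤x+y 1# (0≤fromℕ n) ⟩
    1# + fromℕ n ≈⟨ 1+n≈0 ⟩
    0#           ∎))

  fromℕ≉0 : ∀ n .{{_ : ℕ.NonZero n}} → ¬ fromℕ n ≈ 0#
  fromℕ≉0 (suc n) = fromℕ-suc≉0 n

  ⁻¹-nonNegative : ∀ {x} → 0# ≤ x → ¬ x ≈ 0# → 0# ≤ x ⁻¹
  ⁻¹-nonNegative {x} 0≤x x≉0 = begin
    0#                 ≤⟨ *-nonNegative 0≤x (square-nonNegative (x ⁻¹)) ⟩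
    x * (x ⁻¹ * x ⁻¹)  ≈⟨ *-assoc x (x ⁻¹) (x ⁻¹) ⟨
    x * x ⁻¹ * x ⁻¹    ≈⟨ *-congʳ (*-inverseʳ x x≉0) ⟩
    1# * x ⁻¹          ≈⟨ *-identityˡ (x ⁻¹) ⟩
    x ⁻¹               ∎

  fromℕ⁻¹-nonNegative : ∀ n .{{_ : ℕ.NonZero n}} → 0# ≤ fromℕ n ⁻¹
  fromℕ⁻¹-nonNegative n = ⁻¹-nonNegative (0≤fromℕ n) (fromℕ≉0 n)

  x⁻¹*[x*y]≈y : ∀ {x} y → ¬ x ≈ 0# → x ⁻¹ * (x * y) ≈ y
  x⁻¹*[x*y]≈y {x} y x≉0 = begin-equality
    x ⁻¹ * (x * y) ≈⟨ solve 3 (λ x u y → u :* (x :* y) := (x :* u) :* y) refl x (x ⁻¹) y ⟩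
    x * x ⁻¹ * y   ≈⟨ *-congʳ (*-inverseʳ x x≉0) ⟩
    1# * y         ≈⟨ *-identityˡ y ⟩
    y              ∎

  *-cancelˡ-≤ : ∀ {x y z} → 0# ≤ x → ¬ x ≈ 0# → x * y ≤ x * z → y ≤ z
  *-cancelˡ-≤ {x} {y} {z} 0≤x x≉0 xy≤xz = begin
    y              ≈⟨ x⁻¹*[x*y]≈y y x≉0 ⟨
    x ⁻¹ * (x * y) ≤⟨ *-monoˡ-≤-nonNeg (⁻¹-nonNegative 0≤x x≉0) xy≤xz ⟩
    x ⁻¹ * (x * z) ≈⟨ x⁻¹*[x*y]≈y z x≉0 ⟩
    z              ∎

  ^-nonNegative : ∀ {x} → 0# ≤ x → ∀ n → 0# ≤ x ^ n
  ^-nonNegative 0≤x zero    = 0≤1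
  ^-nonNegative 0≤x (suc n) = *-nonNegative 0≤x (^-nonNegative 0≤x n)

  sum-mono-≤ : ∀ n {f g : Vector Carrier n} → (∀ i → f i ≤ g i) → sum f ≤ sum g
  sum-mono-≤ zero    f≤g = ≤-refl
  sum-mono-≤ (suc n) f≤g = +-mono-≤ (f≤g zero) (sum-mono-≤ n (f≤g ∘ suc))

  x+x≤1+x² : ∀ x → x + x ≤ 1# + x * x
  x+x≤1+x² x = begin
    x + x                         ≤⟨ x≤x+y (x + x) (square-nonNegative y) ⟩
    x + x + y * y                 ≈⟨ +-congʳ (*-identityʳ (x + x)) ⟨
    (x + x) * 1# + y * y          ≈⟨ +-congʳ (*-congˡ (x+[y-x]≈y x 1#)) ⟨
    (x + x) * (x + y) + y * y     ≈⟨ solve 2 (λ x y → (x :+ x) :* (x :+ y) :+ y :* y :=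
                                       (x :+ y) :* (x :+ y) :+ x :* x) refl x y ⟩
    (x + y) * (x + y) + x * x     ≈⟨ +-congʳ (*-cong (x+[y-x]≈y x 1#) (x+[y-x]≈y x 1#)) ⟩
    1# * 1# + x * x               ≈⟨ +-congʳ (*-identityˡ 1#) ⟩
    1# + x * x                    ∎
    where y = 1# - x

  -- After multiplication by m + 1 and use of the relation between q and r, the two sides of
  -- the inductive step differ by j qʲ⁻¹ (1 - q)².
  tangent-power-≤ : ∀ m {q r} → 0# ≤ q → fromℕ (suc m) * r ≈ fromℕ m * q + 1# →
                    ∀ j e → j ℕ.+ e ≡ suc m →
                    fromℕ j * q ^ pred j + fromℕ e * q ^ j ≤ fromℕ (suc m) * r ^ j
  tangent-power-≤ m {q} {r} 0≤q Mr≈mq+1 zero e ≡.refl = ≤-reflexive (begin-equality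
    0# * 1# + fromℕ (suc m) * 1# ≈⟨ +-congʳ (zeroˡ 1#) ⟩
    0# + fromℕ (suc m) * 1#      ≈⟨ +-identityˡ _ ⟩
    fromℕ (suc m) * 1#           ∎)
  tangent-power-≤ m {q} {r} 0≤q Mr≈mq+1 (suc zero) e ≡.refl = ≤-reflexive (begin-equality
    (1# + 0#) * 1# + fromℕ m * (q * 1#)
      ≈⟨ +-cong (trans (*-identityʳ _) (+-identityʳ 1#)) (*-congˡ (*-identityʳ q)) ⟩
    1# + fromℕ m * q                    ≈⟨ +-comm 1# (fromℕ m * q) ⟩
    fromℕ m * q + 1#                    ≈⟨ Mr≈mq+1 ⟨
    fromℕ (suc m) * r                   ≈⟨ *-congˡ (*-identityʳ r) ⟨
    fromℕ (suc m) * (r * 1#)            ∎)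
  tangent-power-≤ m {q} {r} 0≤q Mr≈mq+1 (suc (suc i)) e ≡.refl =
    *-cancelˡ-≤ (0≤fromℕ (suc m)) (fromℕ-suc≉0 m) (begin
      fromℕ (suc m) * next                     ≤⟨ +-cancelʳ-≤ (jP * (q + q)) (begin
        fromℕ (suc m) * next + jP * (q + q)
          ≤⟨ +-monoʳ-≤ _ (*-monoˡ-≤-nonNeg 0≤jP (x+x≤1+x² q)) ⟩
        fromℕ (suc m) * next + jP * (1# + q * q)  ≈⟨ expand ⟩
        mq+1 * prev + jP * (q + q)                ∎) ⟩
      mq+1 * prev                              ≤⟨ *-monoˡ-≤-nonNeg 0≤mq+1
                                                  (tangent-power-≤ m 0≤q Mr≈mq+1 (suc i) (suc e)
                                                    (≡.cong suc (ℕₚ.+-suc i e))) ⟩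
      mq+1 * (fromℕ (suc m) * r ^ suc i)       ≈⟨ *-congʳ Mr≈mq+1 ⟨
      (fromℕ (suc m) * r) * (fromℕ (suc m) * r ^ suc i)
        ≈⟨ solve 3 (λ M r s → (M :* r) :* (M :* s) := M :* (M :* (r :* s))) refl (fromℕ (suc m)) r (r ^ suc i) ⟩
      fromℕ (suc m) * (fromℕ (suc m) * r ^ suc (suc i)) ∎)
    where
    next = fromℕ (suc (suc i)) * q ^ suc i + fromℕ e * q ^ suc (suc i)
    prev = fromℕ (suc i) * q ^ i + fromℕ (suc e) * q ^ suc i
    mq+1 = fromℕ m * q + 1#
    jP   = fromℕ (suc i) * q ^ i

    0≤jP : 0# ≤ jP
    0≤jP = *-nonNegative (0≤fromℕ (suc i)) (^-nonNegative 0≤q i)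

    0≤mq+1 : 0# ≤ mq+1
    0≤mq+1 = +-nonNegative (*-nonNegative (0≤fromℕ m) 0≤q) 0≤1

    m≈1+i+e : fromℕ m ≈ 1# + (fromℕ i + fromℕ e)
    m≈1+i+e = +-congˡ (fromℕ-+ i e)

    expand : fromℕ (suc m) * next + jP * (1# + q * q) ≈ mq+1 * prev + jP * (q + q)
    expand = begin-equality
      fromℕ (suc m) * next + jP * (1# + q * q) ≈⟨ +-congʳ (*-congʳ (+-congˡ m≈1+i+e)) ⟩
      (1# + (1# + (fromℕ i + fromℕ e))) * next + jP * (1# + q * q)
        ≈⟨ solve 4 (λ I E q P →
             (con 1 :+ (con 1 :+ (I :+ E))) :* ((con 1 :+ (con 1 :+ I)) :* (q :* P) :+ E :* (q :* (q :* P)))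
               :+ ((con 1 :+ I) :* P) :* (con 1 :+ q :* q) :=
             ((con 1 :+ (I :+ E)) :* q :+ con 1) :* ((con 1 :+ I) :* P :+ (con 1 :+ E) :* (q :* P))
               :+ ((con 1 :+ I) :* P) :* (q :+ q)) refl (fromℕ i) (fromℕ e) q (q ^ i) ⟩
      ((1# + (fromℕ i + fromℕ e)) * q + 1#) * prev + jP * (q + q)
        ≈⟨ +-congʳ (*-congʳ (+-congʳ (*-congʳ m≈1+i+e))) ⟨
      mq+1 * prev + jP * (q + q) ∎

  sum-reindex : ∀ n (α β : ℕ → Carrier) →
    sum {suc n} (λ j → fromℕ (toℕ j) * α (toℕ j) + fromℕ (n ∸ toℕ j) * β (toℕ j)) ≈
    sum {n} (λ l → fromℕ (suc (toℕ l)) * α (suc (toℕ l)) + fromℕ (n ∸ toℕ l) * β (toℕ l))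
  sum-reindex n α β = begin-equality
    sum {suc n} (λ j → A (toℕ j) + B n β (toℕ j))
      ≈⟨ ∑-distrib-+ {suc n} (A ∘ toℕ) (B n β ∘ toℕ) ⟩
    (0# * α 0 + sum {n} (A ∘ suc ∘ toℕ)) + sum {suc n} (B n β ∘ toℕ)
      ≈⟨ +-cong (trans (+-congʳ (zeroˡ (α 0))) (+-identityˡ _)) (dropLast n β) ⟩
    sum {n} (A ∘ suc ∘ toℕ) + sum {n} (B n β ∘ toℕ)
      ≈⟨ ∑-distrib-+ {n} (A ∘ suc ∘ toℕ) (B n β ∘ toℕ) ⟨
    sum {n} (λ l → A (suc (toℕ l)) + B n β (toℕ l))                      ∎
    where
    A : ℕ → Carrier
    A j = fromℕ j * α j
    B : ℕ → (ℕ → Carrier) → ℕ → Carrier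
    B n β j = fromℕ (n ∸ j) * β j
    dropLast : ∀ n β → sum {suc n} (B n β ∘ toℕ) ≈ sum {n} (B n β ∘ toℕ)
    dropLast zero    β = trans (+-identityʳ _) (zeroˡ (β 0))
    dropLast (suc n) β = +-congˡ (dropLast n (β ∘ suc))

  weightedPower : ℕ → Carrier → Carrier → ℕ → Carrier
  weightedPower m b q l = (fromℕ (suc l) * b + fromℕ (suc m ∸ l)) * q ^ l

  -- (m + 1) (m + 2) times the integral over [0,1] of (1 - t + t b) (1 - t + t q)ᵐ.
  weightedPowers : ℕ → Carrier → Carrier → Carrier
  weightedPowers m b q =
    sum {suc m} λ l → weightedPower m b q (toℕ l)

  weightedPowers-mono : ∀ m {b q r} → 0# ≤ b → 0# ≤ q → fromℕ (suc m) * r ≈ fromℕ m * q + 1# →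
    fromℕ (3 ℕ.+ m) * weightedPowers m b q ≤ fromℕ (suc m) * weightedPowers (suc m) b r
  weightedPowers-mono m {b} {q} {r} 0≤b 0≤q Mr≈mq+1 = begin
    fromℕ (3 ℕ.+ m) * weightedPowers m b q
      ≈⟨ *-distribˡ-sum {suc m} (fromℕ (3 ℕ.+ m)) (weightedPower m b q ∘ toℕ) ⟩
    sum {suc m} (λ l → fromℕ (3 ℕ.+ m) * weightedPower m b q (toℕ l))
      ≈⟨ sum-cong-≋ (λ l → split (toℕ l) (ℕₚ.≤-pred (toℕ<n l))) ⟩
    sum {suc m} (λ l → fromℕ (suc (toℕ l)) * α (suc (toℕ l)) + fromℕ (suc m ∸ toℕ l) * β (toℕ l))
      ≈⟨ sum-reindex (suc m) α β ⟨
    sum {2 ℕ.+ m} (λ j → fromℕ (toℕ j) * α (toℕ j) + fromℕ (suc m ∸ toℕ j) * β (toℕ j))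
      ≤⟨ sum-mono-≤ (2 ℕ.+ m) (λ j → bound (toℕ j) (ℕₚ.≤-pred (toℕ<n j))) ⟩
    sum {2 ℕ.+ m} (λ j → fromℕ (suc m) * (coef (toℕ j) * r ^ toℕ j))
      ≈⟨ *-distribˡ-sum {2 ℕ.+ m} (fromℕ (suc m)) (λ j → coef (toℕ j) * r ^ toℕ j) ⟨
    fromℕ (suc m) * weightedPowers (suc m) b r ∎
    where
    coef α β : ℕ → Carrier
    coef j = fromℕ (suc j) * b + fromℕ (2 ℕ.+ m ∸ j)
    α j = coef j * q ^ pred j
    β j = coef j * q ^ j

    0≤coef : ∀ j → 0# ≤ coef j
    0≤coef j = +-nonNegative (*-nonNegative (0≤fromℕ (suc j)) 0≤b) (0≤fromℕ (2 ℕ.+ m ∸ j))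

    bound : ∀ j → j ℕ.≤ suc m →
            fromℕ j * α j + fromℕ (suc m ∸ j) * β j ≤ fromℕ (suc m) * (coef j * r ^ j)
    bound j j≤1+m = begin
      fromℕ j * α j + fromℕ (suc m ∸ j) * β j
        ≈⟨ solve 5 (λ J E k p s → J :* (k :* p) :+ E :* (k :* s) := k :* (J :* p :+ E :* s)) refl
             (fromℕ j) (fromℕ (suc m ∸ j)) (coef j) (q ^ pred j) (q ^ j) ⟩
      coef j * (fromℕ j * q ^ pred j + fromℕ (suc m ∸ j) * q ^ j)
        ≤⟨ *-monoˡ-≤-nonNeg (0≤coef j) (tangent-power-≤ m 0≤q Mr≈mq+1 j (suc m ∸ j) (ℕₚ.m+[n∸m]≡n j≤1+m)) ⟩
      coef j * (fromℕ (suc m) * r ^ j)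
        ≈⟨ solve 3 (λ k M s → k :* (M :* s) := M :* (k :* s)) refl (coef j) (fromℕ (suc m)) (r ^ j) ⟩
      fromℕ (suc m) * (coef j * r ^ j) ∎

    split : ∀ l → l ℕ.≤ m →
            fromℕ (3 ℕ.+ m) * weightedPower m b q l ≈
            fromℕ (suc l) * α (suc l) + fromℕ (suc m ∸ l) * β l
    split l l≤m = begin-equality
      fromℕ (3 ℕ.+ m) * weightedPower m b q l
        ≈⟨ *-cong (+-congˡ (+-congˡ (+-congˡ m≈l+e))) (*-congʳ (+-congˡ 1+m∸l)) ⟩
      (1# + (1# + (1# + (L + E)))) * (((1# + L) * b + (1# + E)) * q ^ l)
        ≈⟨ solve 4 (λ L E b P →
             (con 1 :+ (con 1 :+ (con 1 :+ (L :+ E)))) :* (((con 1 :+ L) :* b :+ (con 1 :+ E)) :* P) :=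
             (con 1 :+ L) :* (((con 1 :+ (con 1 :+ L)) :* b :+ (con 1 :+ E)) :* P) :+
             (con 1 :+ E) :* (((con 1 :+ L) :* b :+ (con 1 :+ (con 1 :+ E))) :* P))
             refl L E b (q ^ l) ⟩
      (1# + L) * (((1# + (1# + L)) * b + (1# + E)) * q ^ l) +
      (1# + E) * (((1# + L) * b + (1# + (1# + E))) * q ^ l)
        ≈⟨ +-cong (*-congˡ (*-congʳ (+-congˡ 1+m∸l))) (*-cong 1+m∸l (*-congʳ (+-congˡ 2+m∸l))) ⟨
      fromℕ (suc l) * α (suc l) + fromℕ (suc m ∸ l) * β l ∎
      where
      L = fromℕ l
      E = fromℕ (m ∸ l)
      m≈l+e : fromℕ m ≈ L + E
      m≈l+e = trans (fromℕ-≡ (≡.sym (ℕₚ.m+[n∸m]≡n l≤m))) (fromℕ-+ l (m ∸ l))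
      1+m∸l : fromℕ (suc m ∸ l) ≈ 1# + E
      1+m∸l = fromℕ-≡ (ℕₚ.+-∸-assoc 1 l≤m)
      2+m∸l : fromℕ (2 ℕ.+ m ∸ l) ≈ 1# + (1# + E)
      2+m∸l = trans (fromℕ-≡ (ℕₚ.+-∸-assoc 1 (m≤n⇒m≤1+n l≤m))) (+-congˡ 1+m∸l)

  -- Sums over permutations

  sumOver : ∀ {a} {A : Set a} → List A → (A → Carrier) → Carrier
  sumOver xs f = sumList (map f xs)

  sumOver-cong : ∀ {a} {A : Set a} (xs : List A) {f g : A → Carrier} →
                 (∀ x → f x ≈ g x) → sumOver xs f ≈ sumOver xs g
  sumOver-cong []       f≈g = refl
  sumOver-cong (x ∷ xs) f≈g = +-cong (f≈g x) (sumOver-cong xs f≈g)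

  sumOver-++ : ∀ {a} {A : Set a} (xs ys : List A) f → sumOver (xs ++ ys) f ≈ sumOver xs f + sumOver ys f
  sumOver-++ []       ys f = sym (+-identityˡ _)
  sumOver-++ (x ∷ xs) ys f = trans (+-congˡ (sumOver-++ xs ys f)) (sym (+-assoc _ _ _))

  sumOver-linear : ∀ {a} {A : Set a} (xs : List A) x y (f g : A → Carrier) →
    sumOver xs (λ z → x * f z + y * g z) ≈ x * sumOver xs f + y * sumOver xs g
  sumOver-linear []       x y f g =
    sym (trans (+-cong (zeroʳ x) (zeroʳ y)) (+-identityˡ 0#))
  sumOver-linear (z ∷ zs) x y f g = trans (+-congˡ (sumOver-linear zs x y f g))
    (solve 6 (λ x y fz gz F G → (x :* fz :+ y :* gz) :+ (x :* F :+ y :* G) :=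
                x :* (fz :+ F) :+ y :* (gz :+ G)) refl x y (f z) (g z) (sumOver zs f) (sumOver zs g))

  *-distribˡ-sumOver : ∀ {a} {A : Set a} x (xs : List A) (f : A → Carrier) →
    sumOver xs (λ z → x * f z) ≈ x * sumOver xs f
  *-distribˡ-sumOver x []       f = sym (zeroʳ x)
  *-distribˡ-sumOver x (z ∷ zs) f =
    trans (+-congˡ (*-distribˡ-sumOver x zs f)) (sym (distribˡ x (f z) (sumOver zs f)))

  sumOver-map : ∀ {a b} {A : Set a} {B : Set b} (g : A → B) xs f → sumOver (map g xs) f ≈ sumOver xs (f ∘ g)
  sumOver-map g []       f = refl
  sumOver-map g (x ∷ xs) f = +-congˡ (sumOver-map g xs f)

  sumOver-cartesianProductWith : ∀ {a b d} {A : Set a} {B : Set b} {D : Set d}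
    (g : A → B → D) xs ys f →
    sumOver (cartesianProductWith g xs ys) f ≈ sumOver xs (λ x → sumOver ys (f ∘ g x))
  sumOver-cartesianProductWith g []       ys f = refl
  sumOver-cartesianProductWith g (x ∷ xs) ys f = trans
    (sumOver-++ (map (g x) ys) (cartesianProductWith g xs ys) f)
    (+-cong (sumOver-map (g x) ys f) (sumOver-cartesianProductWith g xs ys f))

  sumOver-tabulate : ∀ {a} {A : Set a} n (g : Fin n → A) f → sumOver (tabulate g) f ≈ sum (f ∘ g)
  sumOver-tabulate zero    g f = refl
  sumOver-tabulate (suc n) g f = +-congˡ (sumOver-tabulate n (g ∘ suc) f)

  sumPerm : ∀ n → (Permutation′ n → Carrier) → Carrier
  sumPerm n = sumOver (permutations n)

  sumPerm-suc : ∀ n f → sumPerm (suc n) f ≈ sum {suc n} (λ j → sumPerm n (f ∘ insert zero j))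
  sumPerm-suc n f = trans
    (sumOver-cartesianProductWith (insert zero) (tabulate (λ j → j)) (permutations n) f)
    (sumOver-tabulate (suc n) (λ j → j) (λ j → sumPerm n (f ∘ insert zero j)))

  product-cong : {f g : Vector Carrier n} → (∀ i → f i ≈ g i) → product f ≈ product g
  product-cong = MonoidSum.sum-cong-≋ *-monoid

  productBelow : Vector Carrier n → ℕ → Permutation′ n → Carrier
  productBelow v j π = product λ i → if toℕ (π ⟨$⟩ʳ i) <ᵇ j then v i else 1#

  if-≡ : ∀ {b b′ : Bool} (x y : Carrier) → b ≡ b′ →
         (if b then x else y) ≈ (if b′ then x else y)
  if-≡ x y ≡.refl = refl

  productBelow-insert-< : ∀ (v : Vector Carrier (suc n)) j (l : Fin (suc n)) π → toℕ l ℕ.≤ j →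
    productBelow v (suc j) (insert zero l π) ≈ v zero * productBelow (v ∘ suc) j π
  productBelow-insert-< v j l π l≤j = *-cong
    (if-≡ (v zero) 1# (<⇒<ᵇ≡true (s≤s l≤j)))
    (product-cong λ i → if-≡ (v (suc i)) 1# (≡.trans
      (≡.cong (λ p → toℕ p <ᵇ suc j) (insert-punchIn zero l π i))
      (punchIn-<ᵇ-suc l (π ⟨$⟩ʳ i) j l≤j)))

  productBelow-insert-≥ : ∀ (v : Vector Carrier (suc n)) j (l : Fin (suc n)) π → j ℕ.≤ toℕ l →
    productBelow v j (insert zero l π) ≈ productBelow (v ∘ suc) j π
  productBelow-insert-≥ v j l π j≤l = trans (*-cong
    (if-≡ (v zero) 1# (≥⇒<ᵇ≡false j≤l))
    (product-cong λ i → if-≡ (v (suc i)) 1# (≡.trans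
      (≡.cong (λ p → toℕ p <ᵇ j) (insert-punchIn zero l π i))
      (punchIn-<ᵇ l (π ⟨$⟩ʳ i) j j≤l))))
    (*-identityˡ _)

  sum-if-<ᵇ : ∀ n j → j ℕ.≤ n → ∀ x y →
    sum {n} (λ l → if toℕ l <ᵇ j then x else y) ≈ fromℕ j * x + fromℕ (n ∸ j) * y
  sum-if-<ᵇ zero    zero    _         x y = sym (trans (+-cong (zeroˡ x) (zeroˡ y)) (+-identityˡ 0#))
  sum-if-<ᵇ (suc n) zero    _         x y = trans (+-congˡ (sum-if-<ᵇ n zero z≤n x y))
    (solve 4 (λ z N x y → y :+ (z :* x :+ N :* y) := z :* x :+ (con 1 :+ N) :* y) refl 0# (fromℕ n) x y)
  sum-if-<ᵇ (suc n) (suc j) (s≤s j≤n) x y = trans (+-congˡ (sum-if-<ᵇ n j j≤n x y))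
    (solve 4 (λ J E x y → x :+ (J :* x :+ E :* y) := (con 1 :+ J) :* x :+ E :* y) refl
      (fromℕ j) (fromℕ (n ∸ j)) x y)

  mutual
    sumPerm-productBelow-suc : ∀ n (v : Vector Carrier (suc n)) {q} → (∀ i → v (suc i) ≈ q) →
      ∀ j → j ℕ.≤ suc n →
      sumPerm (suc n) (productBelow v j) ≈
      fromℕ j * (v zero * (fromℕ (n !) * q ^ pred j)) + fromℕ (suc n ∸ j) * (fromℕ (n !) * q ^ j)
    sumPerm-productBelow-suc n v {q} v≈q j j≤1+n = begin-equality
      sumPerm (suc n) (productBelow v j)
        ≈⟨ sumPerm-suc n (productBelow v j) ⟩
      sum {suc n} (λ l → sumPerm n (productBelow v j ∘ insert zero l))
        ≈⟨ sum-cong-≋ {suc n} (λ l → fibre l j j≤1+n) ⟩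
      sum {suc n} (λ l → if toℕ l <ᵇ j then v zero * (fromℕ (n !) * q ^ pred j) else fromℕ (n !) * q ^ j)
        ≈⟨ sum-if-<ᵇ (suc n) j j≤1+n _ _ ⟩
      fromℕ j * (v zero * (fromℕ (n !) * q ^ pred j)) + fromℕ (suc n ∸ j) * (fromℕ (n !) * q ^ j) ∎
      where
      fibre : ∀ (l : Fin (suc n)) j → j ℕ.≤ suc n →
        sumPerm n (productBelow v j ∘ insert zero l) ≈
        (if toℕ l <ᵇ j then v zero * (fromℕ (n !) * q ^ pred j) else fromℕ (n !) * q ^ j)
      fibre l j j≤1+n with ℕₚ.≤-<-connex j (toℕ l)
      fibre l j j≤1+n | inj₁ j≤l = begin-equality
        sumPerm n (productBelow v j ∘ insert zero l)
          ≈⟨ sumOver-cong (permutations n) (λ π → productBelow-insert-≥ v j l π j≤l) ⟩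
        sumPerm n (productBelow (v ∘ suc) j)
          ≈⟨ sumPerm-productBelow n (v ∘ suc) v≈q j (ℕₚ.≤-trans j≤l (ℕₚ.≤-pred (toℕ<n l))) ⟩
        fromℕ (n !) * q ^ j
          ≈⟨ if-≡ _ _ (≥⇒<ᵇ≡false j≤l) ⟨
        _ ∎
      fibre l (suc j) (s≤s j≤n) | inj₂ (s≤s l≤j) = begin-equality
        sumPerm n (productBelow v (suc j) ∘ insert zero l)
          ≈⟨ sumOver-cong (permutations n) (λ π → productBelow-insert-< v j l π l≤j) ⟩
        sumPerm n (λ π → v zero * productBelow (v ∘ suc) j π)
          ≈⟨ *-distribˡ-sumOver (v zero) (permutations n) (productBelow (v ∘ suc) j) ⟩
        v zero * sumPerm n (productBelow (v ∘ suc) j)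
          ≈⟨ *-congˡ (sumPerm-productBelow n (v ∘ suc) v≈q j j≤n) ⟩
        v zero * (fromℕ (n !) * q ^ j)
          ≈⟨ if-≡ _ _ (<⇒<ᵇ≡true (s≤s l≤j)) ⟨
        _ ∎

    sumPerm-productBelow : ∀ n (v : Vector Carrier n) {q} → (∀ i → v i ≈ q) → ∀ j → j ℕ.≤ n →
      sumPerm n (productBelow v j) ≈ fromℕ (n !) * q ^ j
    sumPerm-productBelow zero    v v≈q zero    _ = sym (*-identityʳ (1# + 0#))
    sumPerm-productBelow (suc n) v {q} v≈q zero _ = begin-equality
      sumPerm (suc n) (productBelow v 0)
        ≈⟨ sumPerm-productBelow-suc n v (v≈q ∘ suc) 0 z≤n ⟩
      0# * (v zero * (fromℕ (n !) * 1#)) + fromℕ (suc n) * (fromℕ (n !) * 1#)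
        ≈⟨ trans (+-congʳ (zeroˡ _)) (+-identityˡ _) ⟩
      fromℕ (suc n) * (fromℕ (n !) * 1#)
        ≈⟨ *-assoc _ _ _ ⟨
      fromℕ (suc n) * fromℕ (n !) * 1#
        ≈⟨ *-congʳ (fromℕ-* (suc n) (n !)) ⟨
      fromℕ (suc n !) * 1# ∎
    sumPerm-productBelow (suc n) v {q} v≈q (suc j) (s≤s j≤n) = begin-equality
      sumPerm (suc n) (productBelow v (suc j))
        ≈⟨ sumPerm-productBelow-suc n v (v≈q ∘ suc) (suc j) (s≤s j≤n) ⟩
      fromℕ (suc j) * (v zero * (fromℕ (n !) * q ^ j)) + fromℕ (n ∸ j) * (fromℕ (n !) * (q * q ^ j))
        ≈⟨ +-congʳ (*-congˡ (*-congʳ (v≈q zero))) ⟩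
      fromℕ (suc j) * (q * (fromℕ (n !) * q ^ j)) + fromℕ (n ∸ j) * (fromℕ (n !) * (q * q ^ j))
        ≈⟨ solve 5 (λ J E N q P → J :* (q :* (N :* P)) :+ E :* (N :* (q :* P)) :=
             ((J :+ E) :* N) :* (q :* P)) refl (fromℕ (suc j)) (fromℕ (n ∸ j)) (fromℕ (n !)) q (q ^ j) ⟩
      (fromℕ (suc j) + fromℕ (n ∸ j)) * fromℕ (n !) * q ^ suc j
        ≈⟨ *-congʳ (*-congʳ (fromℕ-+ (suc j) (n ∸ j))) ⟨
      fromℕ (suc j ℕ.+ (n ∸ j)) * fromℕ (n !) * q ^ suc j
        ≈⟨ *-congʳ (*-congʳ (fromℕ-≡ (≡.cong suc (ℕₚ.m+[n∸m]≡n j≤n)))) ⟩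
      fromℕ (suc n) * fromℕ (n !) * q ^ suc j
        ≈⟨ *-congʳ (fromℕ-* (suc n) (n !)) ⟨
      fromℕ (suc n !) * q ^ suc j ∎

  productBefore : Vector Carrier n → Fin n → Permutation′ n → Carrier
  productBefore w i σ = productBelow w (toℕ (σ ⟨$⟩ʳ i)) σ

  sumPerm-productBefore-zero : ∀ m (w : Vector Carrier (2 ℕ.+ m)) {q} → (∀ i → w (suc (suc i)) ≈ q) →
    sumPerm (2 ℕ.+ m) (productBefore w zero) ≈ fromℕ (m !) * weightedPowers m (w (suc zero)) q
  sumPerm-productBefore-zero m w {q} w≈q = begin-equality
    sumPerm (2 ℕ.+ m) (productBefore w zero)
      ≈⟨ sumPerm-suc (suc m) (productBefore w zero) ⟩
    sum {2 ℕ.+ m} (λ j → sumPerm (suc m) (productBelow w (toℕ j) ∘ insert zero j))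
      ≈⟨ sum-cong-≋ {2 ℕ.+ m} (λ j → sumOver-cong (permutations (suc m))
           (λ π → productBelow-insert-≥ w (toℕ j) j π ℕₚ.≤-refl)) ⟩
    sum {2 ℕ.+ m} (λ j → sumPerm (suc m) (productBelow (w ∘ suc) (toℕ j)))
      ≈⟨ sum-cong-≋ {2 ℕ.+ m} (λ j → sumPerm-productBelow-suc m (w ∘ suc) w≈q (toℕ j) (ℕₚ.≤-pred (toℕ<n j))) ⟩
    sum {2 ℕ.+ m} (λ j → fromℕ (toℕ j) * (b * (M * q ^ pred (toℕ j))) + fromℕ (suc m ∸ toℕ j) * (M * q ^ toℕ j))
      ≈⟨ sum-reindex (suc m) (λ j → b * (M * q ^ pred j)) (λ j → M * q ^ j) ⟩
    sum {suc m} (λ l → fromℕ (suc (toℕ l)) * (b * (M * q ^ toℕ l)) + fromℕ (suc m ∸ toℕ l) * (M * q ^ toℕ l))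
      ≈⟨ sum-cong-≋ {suc m} (λ l → solve 5 (λ J E b M P → J :* (b :* (M :* P)) :+ E :* (M :* P) :=
           M :* ((J :* b :+ E) :* P)) refl (fromℕ (suc (toℕ l))) (fromℕ (suc m ∸ toℕ l)) b M (q ^ toℕ l)) ⟩
    sum {suc m} (λ l → M * weightedPower m b q (toℕ l))
      ≈⟨ *-distribˡ-sum {suc m} M (weightedPower m b q ∘ toℕ) ⟨
    M * weightedPowers m b q ∎
    where
    b = w (suc zero)
    M = fromℕ (m !)

  sumPerm-productBefore-one : ∀ m (w : Vector Carrier (2 ℕ.+ m)) {q} → (∀ i → w (suc (suc i)) ≈ q) →
    sumPerm (2 ℕ.+ m) (productBefore w (suc zero)) ≈ fromℕ (m !) * weightedPowers m (w zero) q
  sumPerm-productBefore-one m w {q} w≈q = begin-equality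
    sumPerm (2 ℕ.+ m) (productBefore w (suc zero))
      ≈⟨ sumPerm-suc (suc m) (productBefore w (suc zero)) ⟩
    sum {2 ℕ.+ m} (λ j → sumPerm (suc m) (productBefore w (suc zero) ∘ insert zero j))
      ≈⟨ sum-cong-≋ {2 ℕ.+ m} (λ j → sumPerm-suc m (productBefore w (suc zero) ∘ insert zero j)) ⟩
    sum {2 ℕ.+ m} (λ j → sum {suc m} (λ l → sumPerm m (λ ρ →
        productBefore w (suc zero) (insert zero j (insert zero l ρ)))))
      ≈⟨ sum-cong-≋ {2 ℕ.+ m} (λ j → sum-cong-≋ {suc m} (fibre j)) ⟩
    sum {2 ℕ.+ m} (λ j → sum {suc m} (λ l → if toℕ j <ᵇ suc (toℕ l) then a * (M * q ^ toℕ l) else M * q ^ toℕ l))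
      ≈⟨ ∑-comm {2 ℕ.+ m} {suc m} (λ j l → if toℕ j <ᵇ suc (toℕ l) then a * (M * q ^ toℕ l) else M * q ^ toℕ l) ⟩
    sum {suc m} (λ l → sum {2 ℕ.+ m} (λ j → if toℕ j <ᵇ suc (toℕ l) then a * (M * q ^ toℕ l) else M * q ^ toℕ l))
      ≈⟨ sum-cong-≋ {suc m} (λ l → sum-if-<ᵇ (2 ℕ.+ m) (suc (toℕ l)) (m≤n⇒m≤1+n (toℕ<n l)) (a * (M * q ^ toℕ l)) (M * q ^ toℕ l)) ⟩
    sum {suc m} (λ l → fromℕ (suc (toℕ l)) * (a * (M * q ^ toℕ l)) + fromℕ (suc m ∸ toℕ l) * (M * q ^ toℕ l))
      ≈⟨ sum-cong-≋ {suc m} (λ l → solve 5 (λ J E b M P → J :* (b :* (M :* P)) :+ E :* (M :* P) :=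
           M :* ((J :* b :+ E) :* P)) refl (fromℕ (suc (toℕ l))) (fromℕ (suc m ∸ toℕ l)) a M (q ^ toℕ l)) ⟩
    sum {suc m} (λ l → M * weightedPower m a q (toℕ l))
      ≈⟨ *-distribˡ-sum {suc m} M (weightedPower m a q ∘ toℕ) ⟨
    M * weightedPowers m a q ∎
    where
    a = w zero
    M = fromℕ (m !)
    w″ : Vector Carrier m
    w″ i = w (suc (suc i))

    productBelow-≡ : ∀ {i j} σ → i ≡ j → productBelow w i σ ≈ productBelow w j σ
    productBelow-≡ σ ≡.refl = refl

    fibre : ∀ (j : Fin (2 ℕ.+ m)) (l : Fin (suc m)) →
      sumPerm m (λ ρ → productBefore w (suc zero) (insert zero j (insert zero l ρ))) ≈
      (if toℕ j <ᵇ suc (toℕ l) then a * (M * q ^ toℕ l) else M * q ^ toℕ l)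
    fibre j l with ℕₚ.≤-<-connex (toℕ j) (toℕ l)
    ... | inj₁ j≤l = begin-equality
      sumPerm m (λ ρ → productBefore w (suc zero) (insert zero j (insert zero l ρ)))
        ≈⟨ sumOver-cong (permutations m) (λ ρ → begin-equality
             productBefore w (suc zero) (insert zero j (insert zero l ρ))
               ≈⟨ productBelow-≡ (insert zero j (insert zero l ρ)) (≡.trans
                    (≡.cong toℕ (insert-punchIn zero j (insert zero l ρ) zero)) (toℕ-punchIn-≤ j l j≤l)) ⟩
             productBelow w (suc (toℕ l)) (insert zero j (insert zero l ρ))
               ≈⟨ productBelow-insert-< w (toℕ l) j (insert zero l ρ) j≤l ⟩
             a * productBelow (w ∘ suc) (toℕ l) (insert zero l ρ)
               ≈⟨ *-congˡ (productBelow-insert-≥ (w ∘ suc) (toℕ l) l ρ ℕₚ.≤-refl) ⟩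
             a * productBelow w″ (toℕ l) ρ ∎) ⟩
      sumPerm m (λ ρ → a * productBelow w″ (toℕ l) ρ)
        ≈⟨ *-distribˡ-sumOver a (permutations m) (productBelow w″ (toℕ l)) ⟩
      a * sumPerm m (productBelow w″ (toℕ l))
        ≈⟨ *-congˡ (sumPerm-productBelow m w″ w≈q (toℕ l) (ℕₚ.≤-pred (toℕ<n l))) ⟩
      a * (M * q ^ toℕ l)
        ≈⟨ if-≡ _ _ (<⇒<ᵇ≡true (s≤s j≤l)) ⟨
      _ ∎
    ... | inj₂ l<j = begin-equality
      sumPerm m (λ ρ → productBefore w (suc zero) (insert zero j (insert zero l ρ)))
        ≈⟨ sumOver-cong (permutations m) (λ ρ → begin-equality
             productBefore w (suc zero) (insert zero j (insert zero l ρ))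
               ≈⟨ productBelow-≡ (insert zero j (insert zero l ρ)) (≡.trans
                    (≡.cong toℕ (insert-punchIn zero j (insert zero l ρ) zero)) (toℕ-punchIn-> j l l<j)) ⟩
             productBelow w (toℕ l) (insert zero j (insert zero l ρ))
               ≈⟨ productBelow-insert-≥ w (toℕ l) j (insert zero l ρ) (<⇒≤ l<j) ⟩
             productBelow (w ∘ suc) (toℕ l) (insert zero l ρ)
               ≈⟨ productBelow-insert-≥ (w ∘ suc) (toℕ l) l ρ ℕₚ.≤-refl ⟩
             productBelow w″ (toℕ l) ρ ∎) ⟩
      sumPerm m (productBelow w″ (toℕ l))
        ≈⟨ sumPerm-productBelow m w″ w≈q (toℕ l) (ℕₚ.≤-pred (toℕ<n l)) ⟩
      M * q ^ toℕ l
        ≈⟨ if-≡ _ _ (≥⇒<ᵇ≡false l<j) ⟨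
      _ ∎

  -- The functions F and F′

  F-≤1 : ∀ z → F R z ≤ 1#
  F-≤1 z = MinOp.x⊓y≤y (Min.minOperator totalOrder) (fromℕ 11 / fromℕ 6 * z) 1#

  0≤1-F : ∀ z → 0# ≤ 1# - F R z
  0≤1-F z = x≤y⇒0≤y-x (F-≤1 z)

  0≤11/6 : 0# ≤ fromℕ 11 / fromℕ 6
  0≤11/6 = *-nonNegative (0≤fromℕ 11) (fromℕ⁻¹-nonNegative 6)

  F′-nonNegative : ∀ z → 0# ≤ F′ R z
  F′-nonNegative z with does (z ≤? fromℕ 6 / fromℕ 11)
  ... | true  = 0≤11/6
  ... | false = ≤-refl

  11/6-≤ : ∀ n → fromℕ 11 / fromℕ 6 ≤ fromℕ (2 ℕ.+ n)
  11/6-≤ n = begin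
    fromℕ 11 / fromℕ 6                ≈⟨ *-comm (fromℕ 11) (fromℕ 6 ⁻¹) ⟩
    fromℕ 6 ⁻¹ * fromℕ 11
      ≤⟨ *-monoˡ-≤-nonNeg (fromℕ⁻¹-nonNegative 6) (fromℕ-mono-≤ 11≤6[2+n]) ⟩
    fromℕ 6 ⁻¹ * fromℕ (6 ℕ.* (2 ℕ.+ n))      ≈⟨ *-congˡ (fromℕ-* 6 (2 ℕ.+ n)) ⟩
    fromℕ 6 ⁻¹ * (fromℕ 6 * fromℕ (2 ℕ.+ n))  ≈⟨ x⁻¹*[x*y]≈y (fromℕ (2 ℕ.+ n)) (fromℕ≉0 6) ⟩
    fromℕ (2 ℕ.+ n)                   ∎
    where
    11≤6[2+n] : 11 ℕ.≤ 6 ℕ.* (2 ℕ.+ n)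
    11≤6[2+n] = ℕₚ.≤-trans (ℕₚ.n≤1+n 11) (ℕₚ.*-monoʳ-≤ 6 (ℕₚ.m≤m+n 2 n))

  F-linear : ∀ n {s} → s ≤ 1# →
             F R (s / fromℕ (2 ℕ.+ n)) ≈ fromℕ 11 / fromℕ 6 * (s / fromℕ (2 ℕ.+ n))
  F-linear n {s} s≤1 = Min.x≤y⇒x⊓y≈x totalOrder (begin
    e * (s * N ⁻¹)   ≈⟨ solve 3 (λ e s u → e :* (s :* u) := u :* e :* s) refl e s (N ⁻¹) ⟩
    N ⁻¹ * e * s     ≤⟨ *-monoˡ-≤-nonNeg (*-nonNegative 0≤N⁻¹ 0≤11/6) s≤1 ⟩
    N ⁻¹ * e * 1#    ≈⟨ *-identityʳ (N ⁻¹ * e) ⟩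
    N ⁻¹ * e         ≤⟨ *-monoˡ-≤-nonNeg 0≤N⁻¹ (11/6-≤ n) ⟩
    N ⁻¹ * N         ≈⟨ *-comm (N ⁻¹) N ⟩
    N * N ⁻¹         ≈⟨ *-inverseʳ N (fromℕ-suc≉0 (suc n)) ⟩
    1#               ∎)
    where
    e = fromℕ 11 / fromℕ 6
    N = fromℕ (2 ℕ.+ n)
    0≤N⁻¹ : 0# ≤ N ⁻¹
    0≤N⁻¹ = fromℕ⁻¹-nonNegative (2 ℕ.+ n)

  remaining : Carrier → ℕ → Carrier
  remaining s m = 1# - F R (s / fromℕ m)

  remaining-scaled : ∀ n {s} → s ≤ 1# →
    fromℕ (2 ℕ.+ n) * remaining s (2 ℕ.+ n) + fromℕ 11 / fromℕ 6 * s ≈ fromℕ (2 ℕ.+ n)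
  remaining-scaled n {s} s≤1 = begin-equality
    N * q + e * s                      ≈⟨ +-congˡ N*F≈es ⟨
    N * q + N * F R (s / N)            ≈⟨ distribˡ N q (F R (s / N)) ⟨
    N * (q + F R (s / N))              ≈⟨ *-congˡ (trans (+-comm q _) (x+[y-x]≈y _ 1#)) ⟩
    N * 1#                             ≈⟨ *-identityʳ N ⟩
    N                                  ∎
    where
    e = fromℕ 11 / fromℕ 6
    N = fromℕ (2 ℕ.+ n)
    q = remaining s (2 ℕ.+ n)
    N*F≈es : N * F R (s / N) ≈ e * s
    N*F≈es = begin-equality
      N * F R (s / N)     ≈⟨ *-congˡ (F-linear n s≤1) ⟩
      N * (e * (s / N))
        ≈⟨ solve 4 (λ N e s u → N :* (e :* (s :* u)) := u :* (N :* (e :* s))) refl N e s (N ⁻¹) ⟩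
      N ⁻¹ * (N * (e * s)) ≈⟨ x⁻¹*[x*y]≈y (e * s) (fromℕ-suc≉0 (suc n)) ⟩
      e * s               ∎

  remaining-suc : ∀ n {s} → s ≤ 1# →
    fromℕ (3 ℕ.+ n) * remaining s (3 ℕ.+ n) ≈ fromℕ (2 ℕ.+ n) * remaining s (2 ℕ.+ n) + 1#
  remaining-suc n {s} s≤1 = +-cancelʳ es _ _ (begin-equality
    fromℕ (3 ℕ.+ n) * remaining s (3 ℕ.+ n) + es   ≈⟨ remaining-scaled (suc n) s≤1 ⟩
    1# + fromℕ (2 ℕ.+ n)                           ≈⟨ +-congˡ (remaining-scaled n s≤1) ⟨
    1# + (x + es)                                  ≈⟨ +-assoc 1# x es ⟨
    1# + x + es                                    ≈⟨ +-congʳ (+-comm 1# x) ⟩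
    x + 1# + es                                    ∎)
    where
    es = fromℕ 11 / fromℕ 6 * s
    x  = fromℕ (2 ℕ.+ n) * remaining s (2 ℕ.+ n)

  1/x*y-cancelˡ : ∀ {x} y → ¬ x ≈ 0# → x * (1# / x * y) ≈ y
  1/x*y-cancelˡ {x} y x≉0 = trans
    (solve 3 (λ x u y → x :* ((con 1 :* u) :* y) := u :* (x :* y)) refl x (x ⁻¹) y)
    (x⁻¹*[x*y]≈y y x≉0)

  1/!-mono-≤ : ∀ k {x y} → fromℕ (suc k) * x ≤ y → 1# / fromℕ (k !) * x ≤ 1# / fromℕ (suc k !) * y
  1/!-mono-≤ k {x} {y} Kx≤y = *-cancelˡ-≤ (0≤fromℕ (suc k !)) (!≉0 (suc k)) (begin
    fromℕ (suc k !) * (1# / fromℕ (k !) * x)             ≈⟨ *-congʳ (fromℕ-* (suc k) (k !)) ⟩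
    fromℕ (suc k) * fromℕ (k !) * (1# / fromℕ (k !) * x) ≈⟨ *-assoc _ _ _ ⟩
    fromℕ (suc k) * (fromℕ (k !) * (1# / fromℕ (k !) * x)) ≈⟨ *-congˡ (1/x*y-cancelˡ x (!≉0 k)) ⟩
    fromℕ (suc k) * x                                    ≤⟨ Kx≤y ⟩
    y                                                    ≈⟨ 1/x*y-cancelˡ y (!≉0 (suc k)) ⟨
    fromℕ (suc k !) * (1# / fromℕ (suc k !) * y)         ∎)
    where
    !≉0 : ∀ k → ¬ fromℕ (k !) ≈ 0#
    !≉0 k = fromℕ≉0 (k !) {{k ℕₚ.!≢0}}

  module _ (x₁ x₂ : Carrier) where

    mixture : ℕ → Carrier → Carrier
    mixture m q = F′ R x₁ * weightedPowers m (1# - F R x₂) q + F′ R x₂ * weightedPowers m (1# - F R x₁) q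

    mixture-mono : ∀ m {q r} → 0# ≤ q → fromℕ (suc m) * r ≈ fromℕ m * q + 1# →
      fromℕ (3 ℕ.+ m) * mixture m q ≤ fromℕ (suc m) * mixture (suc m) r
    mixture-mono m {q} {r} 0≤q Mr≈mq+1 = begin
      fromℕ (3 ℕ.+ m) * mixture m q
        ≈⟨ pull (fromℕ (3 ℕ.+ m)) _ _ ⟩
      F′ R x₁ * (fromℕ (3 ℕ.+ m) * weightedPowers m (1# - F R x₂) q) +
      F′ R x₂ * (fromℕ (3 ℕ.+ m) * weightedPowers m (1# - F R x₁) q)
        ≤⟨ +-mono-≤
             (*-monoˡ-≤-nonNeg (F′-nonNegative x₁) (weightedPowers-mono m (0≤1-F x₂) 0≤q Mr≈mq+1))
             (*-monoˡ-≤-nonNeg (F′-nonNegative x₂) (weightedPowers-mono m (0≤1-F x₁) 0≤q Mr≈mq+1)) ⟩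
      F′ R x₁ * (fromℕ (suc m) * weightedPowers (suc m) (1# - F R x₂) r) +
      F′ R x₂ * (fromℕ (suc m) * weightedPowers (suc m) (1# - F R x₁) r)
        ≈⟨ pull (fromℕ (suc m)) _ _ ⟨
      fromℕ (suc m) * mixture (suc m) r ∎
      where
      pull : ∀ k y z → k * (F′ R x₁ * y + F′ R x₂ * z) ≈ F′ R x₁ * (k * y) + F′ R x₂ * (k * z)
      pull k y z = solve 5 (λ k a b y z → k :* (a :* y :+ b :* z) := a :* (k :* y) :+ b :* (k :* z))
        refl k (F′ R x₁) (F′ R x₂) y z

    C-formula : ∀ m 3≤k → C R (3 ℕ.+ m) 3≤k x₁ x₂ ≈
      1# / fromℕ ((3 ℕ.+ m) !) * (fromℕ (suc m !) * mixture (suc m) (remaining (1# - x₁ - x₂) (suc m)))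
    C-formula m 3≤k = *-congˡ (begin-equality
      sumPerm (3 ℕ.+ m) _
        ≈⟨ sumOver-linear (permutations (3 ℕ.+ m)) (F′ R x₁) (F′ R x₂)
             (productBefore w zero) (productBefore w (suc zero)) ⟩
      F′ R x₁ * sumPerm (3 ℕ.+ m) (productBefore w zero) + F′ R x₂ * sumPerm (3 ℕ.+ m) (productBefore w (suc zero))
        ≈⟨ +-cong (*-congˡ (sumPerm-productBefore-zero (suc m) w (λ _ → refl)))
                  (*-congˡ (sumPerm-productBefore-one (suc m) w (λ _ → refl))) ⟩
      F′ R x₁ * (M * weightedPowers (suc m) (1# - F R x₂) q) + F′ R x₂ * (M * weightedPowers (suc m) (1# - F R x₁) q)
        ≈⟨ solve 5 (λ k a b y z → a :* (k :* y) :+ b :* (k :* z) := k :* (a :* y :+ b :* z))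
             refl M (F′ R x₁) (F′ R x₂) _ _ ⟩
      M * mixture (suc m) q ∎)
      where
      q = remaining (1# - x₁ - x₂) (suc m)
      M = fromℕ (suc m !)
      x w : Vector Carrier (3 ℕ.+ m)
      x = x₁ ∷ᵥ x₂ ∷ᵥ λ _ → (1# - x₁ - x₂) / fromℕ (suc m)
      w i = 1# - F R (x i)

  x-y≤x : ∀ x {y} → 0# ≤ y → x - y ≤ x
  x-y≤x x {y} 0≤y = begin
    x - y       ≤⟨ x≤x+y (x - y) 0≤y ⟩
    x - y + y   ≈⟨ +-comm (x - y) y ⟩
    y + (x - y) ≈⟨ x+[y-x]≈y y x ⟩
    x           ∎

lemma6p5 : ∀ {c ℓ₁ ℓ₂} (R : CompleteOrderedField c ℓ₁ ℓ₂) → let open CompleteOrderedField R in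
    (k : ℕ) (4≤k : 4 ℕ.≤ k) (x₁ x₂ : Carrier) →
    0# ≤ x₁ → 0# ≤ x₂ → x₁ + x₂ ≤ 1# →
    C R k (<⇒≤ 4≤k) x₁ x₂ ≤ C R (suc k) (m≤n⇒m≤1+n (<⇒≤ 4≤k)) x₁ x₂
lemma6p5 R _ 4≤k@(s≤s (s≤s (s≤s (s≤s (z≤n {n}))))) x₁ x₂ 0≤x₁ 0≤x₂ _ = begin
  C R k (<⇒≤ 4≤k) x₁ x₂                                  ≈⟨ C-formula R x₁ x₂ (suc n) (<⇒≤ 4≤k) ⟩
  1# / fromℕ (k !) * (fromℕ (m !) * D m)                 ≤⟨ 1/!-mono-≤ R k scaled ⟩
  1# / fromℕ (suc k !) * (fromℕ (suc m !) * D (suc m))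
    ≈⟨ C-formula R x₁ x₂ (2 ℕ.+ n) (m≤n⇒m≤1+n (<⇒≤ 4≤k)) ⟨
  C R (suc k) (m≤n⇒m≤1+n (<⇒≤ 4≤k)) x₁ x₂                ∎
  where
  open CompleteOrderedField R hiding (zero)
  open DecTotalOrder decTotalOrder using (poset) renaming (trans to ≤-trans)
  open PartialOrderReasoning poset
  open Solver commutativeSemiring using (solve; _:*_; _:=_)
  m k : ℕ
  m = 2 ℕ.+ n
  k = 2 ℕ.+ m
  s : Carrier
  s = 1# - x₁ - x₂
  D : ℕ → Carrier
  D m = mixture R x₁ x₂ m (remaining R s m)
  s≤1 : s ≤ 1#
  s≤1 = ≤-trans (x-y≤x R (1# - x₁) 0≤x₂) (x-y≤x R 1# 0≤x₁)
  scaled : fromℕ (suc k) * (fromℕ (m !) * D m) ≤ fromℕ (suc m !) * D (suc m)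
  scaled = begin
    fromℕ (suc k) * (fromℕ (m !) * D m)
      ≈⟨ solve 3 (λ K M d → K :* (M :* d) := M :* (K :* d)) refl (fromℕ (suc k)) (fromℕ (m !)) (D m) ⟩
    fromℕ (m !) * (fromℕ (suc k) * D m)
      ≤⟨ *-monoˡ-≤-nonNeg R (0≤fromℕ R (m !))
           (mixture-mono R x₁ x₂ m (0≤1-F R (s / fromℕ m)) (remaining-suc R n s≤1)) ⟩
    fromℕ (m !) * (fromℕ (suc m) * D (suc m))
      ≈⟨ solve 3 (λ M L d → M :* (L :* d) := (L :* M) :* d) refl (fromℕ (m !)) (fromℕ (suc m)) (D (suc m)) ⟩
    fromℕ (suc m) * fromℕ (m !) * D (suc m)
      ≈⟨ *-congʳ (fromℕ-* R (suc m) (m !)) ⟨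
    fromℕ (suc m !) * D (suc m) ∎
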